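{- Given is an unweighted directed graph $G$ that has a directed spanning tree (DST) rooted in a given vertex $r$. No algorithm can enumerate such a DST with preprocessing in $o((\Delta^+)^2)$ and delay in $o(\Delta^+)$, even if $\overline{\Delta^+}\in o(\Delta^+)$, where $\Delta^+$ and $\overline{\Delta^+}$ denote the maximum and the average out-degree of $G$.
   Context: Graphs $G=(V,E)$ have vertex set $V=\{1,\dots,n\}$ and $m=|E|$ edges. An out-branching of a directed graph $G$ is an acyclic subgraph $B=(V,E')$ with $E'\subseteq E$ in which each vertex has in-degree at most $1$. A directed spanning tree (DST) is a weakly connected out-branching; it has $n-1$ edges and exactly one vertex $r$ of in-degree $0$, its root. Model: word RAM with word size in $\Omega(\log n)$. The graph is given by (out-)adjacency lists. The algorithm accesses the input by queries, each taking constant time: a degree query for a vertex $v$ returns the out-degree of $v$; a neighbor query for $v$ returns the next, not yet returned out-adjacency of $v$. The order of the entries in the lists is arbitrary. The root $r$ is part of the input. Enumeration: given the whole input, an enumeration algorithm must, for some single DST $T$ of the graph rooted in $r$, emit each edge of $T$ exactly once (irrevocably). Its delay is the worst-case maximum time the algorithm needs to emit the respective next edge; preprocessing time is additional time spent before emitting the first edge. The lower bound is on worst-case complexity over all inputs, and holds even when restricted to graphs with $\overline{\Delta^+}\in o(\Delta^+)$. -}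

module Defs where

open import Data.Bool.Base using (Bool; if_then_else_; _∧_; _∨_; _xor_)
open import Data.Fin.Base using (Fin; toℕ; fromℕ<)
open import Data.Fin.Properties using (_≟_; nonZeroIndex)
open import Data.Integer.Base using (+_)
open import Data.List.Base
  using (List; []; _∷_; length; map; filter; foldr; allFin; head; drop)
open import Data.List.Membership.Propositional using (_∈_; _∉_)
open import Data.List.Relation.Unary.Unique.Propositional using (Unique)
open import Data.Maybe.Base using (Maybe; just; nothing)
open import Data.Nat.Base
  using (ℕ; zero; suc; _+_; _*_; _∸_; _^_; _/_; _%_; _⊔_; _≤_; _<_; _≡ᵇ_; _<ᵇ_)
open import Data.Nat.ListAction using (sum)
open import Data.Nat.Logarithm using (⌊log₂_⌋)
open import Data.Nat.Properties using (_<?_; m^n≢0)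
open import Data.Product.Base using (_×_; _,_; proj₂; ∃-syntax; Σ-syntax)
import Data.Rational.Unnormalised.Base as ℚᵘ
open ℚᵘ using (ℚᵘ; 0ℚᵘ)
open import Data.Vec.Functional using (updateAt)
open import Level using (0ℓ)
open import Relation.Binary.Construct.Closure.Equivalence using (EqClosure)
open import Relation.Binary.Construct.Closure.Transitive using (TransClosure)
open import Relation.Binary.PropositionalEquality using (_≡_)
open import Relation.Nullary.Decidable using (yes; no)
open import Relation.Nullary.Negation using (¬_)
open import Relation.Unary using (Pred)

------------------------------------------------------------------------
-- Directed graphs and directed spanning trees

-- The adjacency lists are part of the graph: quantifying over all
-- `Digraph n` includes quantifying over all orders of the list entries.
record Digraph (n : ℕ) : Set where
  field
    adj      : Fin n → List (Fin n)
    simple   : ∀ v → Unique (adj v)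
    loopless : ∀ v → v ∉ adj v

  outDegree : Fin n → ℕ
  outDegree v = length (adj v)

  edgeCount : ℕ
  edgeCount = sum (map outDegree (allFin n))

  maxOutDegree : ℕ
  maxOutDegree = foldr _⊔_ 0 (map outDegree (allFin n))

open Digraph

Edge : ℕ → Set
Edge n = Fin n × Fin n

module _ {n : ℕ} where

  Joins : List (Edge n) → Fin n → Fin n → Set
  Joins E′ u v = (u , v) ∈ E′

  inDegree : List (Edge n) → Fin n → ℕ
  inDegree E′ v = length (filter (λ e → proj₂ e ≟ v) E′)

  record IsOutBranching (G : Digraph n) (E′ : List (Edge n)) : Set where
    field
      distinct   : Unique E′
      subgraph   : ∀ u v → (u , v) ∈ E′ → v ∈ adj G u
      acyclic    : ∀ v → ¬ TransClosure (Joins E′) v v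
      inDegree≤1 : ∀ v → inDegree E′ v ≤ 1

  record IsDST (G : Digraph n) (r : Fin n) (E′ : List (Edge n)) : Set where
    field
      outBranching    : IsOutBranching G E′
      weaklyConnected : ∀ u v → EqClosure (Joins E′) u v
      root            : inDegree E′ r ≡ 0

record Instance : Set where
  field
    n      : ℕ
    G      : Digraph n
    r      : Fin n
    hasDST : ∃[ T ] IsDST G r T

Δ⁺ : Instance → ℕ
Δ⁺ I = maxOutDegree (Instance.G I)

avgΔ⁺ : Instance → ℚᵘ
avgΔ⁺ I = (+ edgeCount G) ℚᵘ./ n
  where
  open Instance I
  instance _ = nonZeroIndex r

------------------------------------------------------------------------
-- Word RAM with degree and neighbour queries

data BinOp : Set where
  add sub mul quot rem and or xor shl shr lt eq : BinOp

Reg : Set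
Reg = ℕ

-- The registers are named statically (a program uses finitely many of
-- them); `load` and `store` address the main memory by a word held in a
-- register.
data Instr : Set where
  const     : (dst : Reg) (c : ℕ) → Instr
  binop     : BinOp → (dst x y : Reg) → Instr
  load      : (dst addr : Reg) → Instr
  store     : (addr src : Reg) → Instr
  jump      : (target : ℕ) → Instr
  jumpZero  : (x : Reg) (target : ℕ) → Instr
  degree    : (dst v : Reg) → Instr
  neighbour : (dst v : Reg) → Instr
  emit      : (u v : Reg) → Instr

Program : Set
Program = List Instr

fromBool : Bool → ℕ
fromBool b = if b then 1 else 0

bitwise : (Bool → Bool → Bool) → (bits : ℕ) → ℕ → ℕ → ℕ
bitwise f zero       x y = 0
bitwise f (suc bits) x y =
  fromBool (f (x % 2 ≡ᵇ 1) (y % 2 ≡ᵇ 1)) + 2 * bitwise f bits (x / 2) (y / 2)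

-- Division and remainder by 0 yield 0.  Results are reduced modulo 2 ^ w
-- when they are written to a register.
⟦_⟧ : BinOp → (w : ℕ) → ℕ → ℕ → ℕ
⟦ add  ⟧ w x y       = x + y
⟦ sub  ⟧ w x y       = (x + 2 ^ w) ∸ y
⟦ mul  ⟧ w x y       = x * y
⟦ quot ⟧ w x zero    = 0
⟦ quot ⟧ w x (suc y) = x / suc y
⟦ rem  ⟧ w x zero    = 0
⟦ rem  ⟧ w x (suc y) = x % suc y
⟦ and  ⟧ w x y       = bitwise _∧_ w x y
⟦ or   ⟧ w x y       = bitwise _∨_ w x y
⟦ xor  ⟧ w x y       = bitwise _xor_ w x y
⟦ shl  ⟧ w x y       = x * 2 ^ y
⟦ shr  ⟧ w x y       = _/_ x (2 ^ y) {{m^n≢0 2 y}}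
⟦ lt   ⟧ w x y       = fromBool (x <ᵇ y)
⟦ eq   ⟧ w x y       = fromBool (x ≡ᵇ y)

truncate : (w : ℕ) → ℕ → ℕ
truncate w x = _%_ x (2 ^ w) {{m^n≢0 2 w}}

_[_≔_] : (ℕ → ℕ) → ℕ → ℕ → (ℕ → ℕ)
(f [ i ≔ x ]) j = if j ≡ᵇ i then x else f j

-- Vertices are named 1, …, n; 0 is free to mean "no vertex".
label : ∀ {n} → Fin n → ℕ
label v = suc (toℕ v)

vertex : ∀ n → ℕ → Maybe (Fin n)
vertex n zero = nothing
vertex n (suc k) with k <? n
... | yes k<n = just (fromℕ< k<n)
... | no  _   = nothing

record State (n : ℕ) : Set where
  constructor ⟨_,_,_,_⟩
  field
    pc   : ℕ
    regs : Reg → ℕ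
    mem  : ℕ → ℕ
    -- the out-adjacencies that have not been returned yet
    todo : Fin n → List (Fin n)

open State

module Machine (w : ℕ) (A : Program) {n : ℕ} (G : Digraph n) (r : Fin n) where

  initial : State n
  initial = ⟨ 0 , inputs , (λ _ → 0) , adj G ⟩
    where
    inputs : Reg → ℕ
    inputs 0 = truncate w n
    inputs 1 = truncate w (label r)
    inputs _ = 0

  -- Running off the end of the program means halting.
  fetch : State n → Maybe Instr
  fetch s = head (drop (pc s) A)

  next : State n → State n
  next s = record s { pc = suc (pc s) }

  set : Reg → ℕ → State n → State n
  set dst x s = record s { regs = regs s [ dst ≔ truncate w x ] }

  queryDegree : Maybe (Fin n) → ℕ
  queryDegree nothing  = 0
  queryDegree (just v) = outDegree G v

  -- An exhausted list, or an invalid vertex name, is answered by 0.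
  queryNeighbour : Reg → Maybe (Fin n) → State n → State n
  queryNeighbour dst nothing  s = set dst 0 s
  queryNeighbour dst (just v) s with todo s v
  ... | []     = set dst 0 s
  ... | x ∷ xs = set dst (label x)
                   (record s { todo = updateAt (todo s) v (λ _ → xs) })

  exec : Instr → State n → State n
  exec (const dst c)      s = next (set dst c s)
  exec (binop op dst x y) s = next (set dst (⟦ op ⟧ w (regs s x) (regs s y)) s)
  exec (load dst addr)    s = next (set dst (mem s (regs s addr)) s)
  exec (store addr src)   s =
    next (record s { mem = mem s [ regs s addr ≔ regs s src ] })
  exec (jump target)      s = record s { pc = target }
  exec (jumpZero x target) s =
    if regs s x ≡ᵇ 0 then record s { pc = target } else next s
  exec (degree dst v)     s =
    next (set dst (queryDegree (vertex n (regs s v))) s)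
  exec (neighbour dst v)  s =
    next (queryNeighbour dst (vertex n (regs s v)) s)
  exec (emit u v)         s = next s

  step : State n → State n
  step s with fetch s
  ... | nothing = s
  ... | just i  = exec i s

  run : ℕ → State n
  run zero    = initial
  run (suc t) = step (run t)

  emitted : State n → Maybe (ℕ × ℕ)
  emitted s with fetch s
  ... | just (emit u v) = just (regs s u , regs s v)
  ... | _               = nothing

  -- The pair of words emitted by the t-th step (counted from 0), if any.
  emission : ℕ → Maybe (ℕ × ℕ)
  emission t = emitted (run t)

  -- `EmitsFrom delay t budget es`: from step t on, exactly the edges es are
  -- emitted, in this order; the first one takes at most `budget` steps and
  -- each further one at most `delay` steps after its predecessor.
  -- Termination is not demanded, nor is the time after the last edge bounded.
  data EmitsFrom (delay : ℕ) : (t budget : ℕ) → List (Edge n) → Set where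
    done : ∀ {t budget} →
           (∀ t′ → t ≤ t′ → emission t′ ≡ nothing) →
           EmitsFrom delay t budget []
    emit : ∀ {t budget u v es} (t₁ : ℕ) → t ≤ t₁ → t₁ < t + budget →
           (∀ t′ → t ≤ t′ → t′ < t₁ → emission t′ ≡ nothing) →
           emission t₁ ≡ just (label u , label v) →
           EmitsFrom delay (suc t₁) delay es →
           EmitsFrom delay t budget ((u , v) ∷ es)

  -- Preprocessing is time in addition to the delay of the first edge.
  EnumeratesDST : (preprocessing delay : ℕ) → Set
  EnumeratesDST preprocessing delay =
    ∃[ T ] IsDST G r T × EmitsFrom delay 0 (preprocessing + delay) T

------------------------------------------------------------------------
-- Asymptotics

fromℕ : ℕ → ℚᵘ
fromℕ k = (+ k) ℚᵘ./ 1

-- f ∈ o(g) on the class 𝒞, as `size` tends to infinity.  All functions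
-- concerned are meant to be nonnegative.
LittleO : {X : Set} (𝒞 : Pred X 0ℓ) (size : X → ℕ) (f g : X → ℚᵘ) → Set
LittleO 𝒞 size f g =
  ∀ ε → 0ℚᵘ ℚᵘ.< ε →
  ∃[ s₀ ] (∀ x → 𝒞 x → s₀ ≤ size x → f x ℚᵘ.≤ ε ℚᵘ.* g x)

-- The word size w (as a function of n) is in Ω(log n).  That a vertex name
-- fits into one word, i.e. n < 2 ^ w n, is the usual special case; it is not
-- needed to define the machine, which truncates everything to w n bits.
Ω-log : (ℕ → ℕ) → Set
Ω-log w = ∃[ c ] ∃[ n₀ ] (∀ n → n₀ ≤ n → ⌊log₂ n ⌋ ≤ c * w n)

-- A single program, for all inputs, with time bounds that may depend on the
-- whole input.  It has to be correct, and fast, on the class 𝒞 only.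
FastEnumeration : (w : ℕ → ℕ) → Pred Instance 0ℓ → Program → Set
FastEnumeration w 𝒞 A =
  Σ[ preprocessing ∈ (Instance → ℕ) ] Σ[ delay ∈ (Instance → ℕ) ]
    LittleO 𝒞 Δ⁺ (λ I → fromℕ (preprocessing I)) (λ I → fromℕ (Δ⁺ I ^ 2)) ×
    LittleO 𝒞 Δ⁺ (λ I → fromℕ (delay I)) (λ I → fromℕ (Δ⁺ I)) ×
    (∀ I → 𝒞 I → let open Instance I in
      Machine.EnumeratesDST (w n) A G r (preprocessing I) (delay I))

module Submission where

-- The hard graph consists of a root, a core of D vertices and a long directed
-- cycle, the ring.  The root points to the whole core, every core vertex points
-- to the other D - 1 core vertices, and a single edge, the last entry in the
-- list of one core vertex, enters the ring.  The core has D * D entries in its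
-- lists, so after fewer than D * D steps some core vertex a still has its last
-- entry unread, and the emissions up to then do not depend on where, if anywhere,
-- that entry enters the ring.  At most D tree edges lead into the core, so with
-- preprocessing and delay below a quarter of D * D and of D, an edge into some
-- ring vertex j is emitted by that time.  If the entry is j itself, the tree must
-- use the edge from a to j as its only edge into j, so this is the edge emitted;
-- but it is not present if the entry is another ring vertex.

open import Defs
open import Data.Bool.Base using (Bool; true; false)
open import Data.Empty using (⊥)
open import Data.Fin.Base using (Fin; zero; suc; toℕ; inject₁; punchIn; splitAt; _↑ˡ_; _↑ʳ_)
import Data.Fin.Base as Fin
open import Data.Fin.Properties
  using (_≟_; toℕ-injective; toℕ-inject₁; toℕ-fromℕ; toℕ<n; injective⇒≤
        ; punchIn-injective; punchInᵢ≢i; ↑ˡ-injective; ↑ʳ-injective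
        ; splitAt-↑ˡ; splitAt-↑ʳ; splitAt⁻¹-↑ˡ; splitAt⁻¹-↑ʳ)
import Data.Fin.Properties as Fin
import Data.Fin.Relation.Unary.Top as Top
open import Data.Integer.Base using (+_; -[1+_])
import Data.Integer.Base as ℤ
import Data.Integer.Properties as ℤ
open import Data.List.Base
  using (List; []; _∷_; _++_; map; length; foldr; filter; allFin; tabulate; lookup)
open import Data.List.Membership.Propositional using (_∈_; _∉_; lose)
open import Data.List.Membership.Propositional.Properties
  using (∈-lookup; ∈-filter⁺; ∈-filter⁻; ∈-map⁺; ∈-map⁻; ∈-allFin; ∈-++⁺ˡ; ∈-++⁺ʳ; ∈-++⁻)
open import Data.List.Properties
  using (filter-none; map-cong-local; map-tabulate; map-++; length-++; length-map; length-tabulate)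
open import Data.List.Relation.Unary.All as All using (All; []; _∷_)
import Data.List.Relation.Unary.All.Properties as All
open import Data.List.Relation.Unary.AllPairs using ([]; _∷_)
open import Data.List.Relation.Unary.Any using (Any; here; there; any?)
open import Data.List.Relation.Unary.Unique.Propositional using (Unique)
import Data.List.Relation.Unary.Unique.Propositional.Properties as Unique
open import Data.Maybe.Base using (Maybe; just; nothing; maybe′)
open import Data.Maybe.Properties using (just-injective)
open import Data.Nat.Base
  using (ℕ; zero; suc; _+_; _*_; _^_; _⊔_; _≤_; _<_; _≤′_; ≤′-refl; ≤′-step; _≡ᵇ_
        ; NonZero; z≤n; s≤s; s≤s⁻¹)
open import Data.Nat.Induction using (<-wellFounded)
open import Data.Nat.ListAction using (sum)
open import Data.Nat.Properties
  using (_≤?_; ≤-refl; ≤-reflexive; ≤-trans; ≤-antisym; ≤∧≢⇒<; ≤⇒≤′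
        ; <-≤-trans; <-trans; <-irrefl; <-cmp
        ; suc-injective; n≤1+n; n<1+n; 1+n≢n; m≤m+n; m≤n+m; m≤m*n; m≤m⊔n; ⊔-lub
        ; +-comm; +-assoc; +-identityʳ; +-suc; +-mono-≤; +-monoˡ-≤; +-monoʳ-≤; +-cancelˡ-<
        ; *-comm; *-identityʳ; *-monoˡ-≤; *-monoʳ-≤; *-cancelˡ-≤; module ≤-Reasoning)
open import Data.Nat.Tactic.RingSolver using (solve-∀)
open import Data.Product.Base using (_×_; _,_; proj₁; proj₂; ∃-syntax; Σ-syntax)
open import Data.Product.Properties using (≡-dec; ,-injectiveˡ; ,-injectiveʳ)
open import Data.Rational.Unnormalised.Base using (ℚᵘ; mkℚᵘ)
import Data.Rational.Unnormalised.Base as ℚᵘ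
open import Data.Sum.Base using (_⊎_; inj₁; inj₂; [_,_]′)
open import Data.Vec.Functional using (updateAt)
open import Data.Vec.Functional.Properties using (updateAt-updates; updateAt-minimal)
open import Function.Base using (_∘_; id)
open import Induction.WellFounded using (Acc; acc)
open import Relation.Binary.Construct.Closure.Equivalence using (EqClosure)
import Relation.Binary.Construct.Closure.Equivalence as EqClosure
open import Relation.Binary.Construct.Closure.ReflexiveTransitive using (ε; _◅_; _◅◅_)
open import Relation.Binary.Construct.Closure.Symmetric using (fwd; bwd)
open import Relation.Binary.Construct.Closure.Transitive using (TransClosure; [_]; _∷_)
open import Relation.Binary.Definitions using (tri<; tri≈; tri>)
open import Relation.Binary.PropositionalEquality
  using (_≡_; _≢_; refl; sym; trans; cong; cong₂; subst; subst₂; module ≡-Reasoning)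
open import Relation.Nullary.Decidable using (Dec; yes; no; ¬?; decidable-stable)
open import Relation.Nullary.Negation using (¬_; contradiction)
open import Relation.Unary using (U)

open Digraph
open State

private
  variable
    A B : Set
    n   : ℕ

-- Lists without repetitions, and sums over lists

unique-constant⇒length≤1 : {y : A} {xs : List A} → Unique xs → All (_≡ y) xs → length xs ≤ 1
unique-constant⇒length≤1 []                  _                 = z≤n
unique-constant⇒length≤1 (_ ∷ [])            _                 = s≤s z≤n
unique-constant⇒length≤1 ((x≢x ∷ _) ∷ _ ∷ _) (refl ∷ refl ∷ _) = contradiction refl x≢x

length≤1⇒≡ : {x y : A} {xs : List A} → length xs ≤ 1 → x ∈ xs → y ∈ xs → x ≡ y
length≤1⇒≡ {xs = _ ∷ []}    _        (here refl) (here refl) = refl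
length≤1⇒≡ {xs = _ ∷ _ ∷ _} (s≤s ())

unique-map : {f : A → B} {xs : List A} →
             (∀ {x y} → x ∈ xs → y ∈ xs → f x ≡ f y → x ≡ y) → Unique xs → Unique (map f xs)
unique-map inj []       = []
unique-map inj (x∉ ∷ u) =
  All.map⁺ (All.tabulate λ y∈ fx≡fy → All.lookup x∉ y∈ (inj (here refl) (there y∈) fx≡fy))
  ∷ unique-map (λ p q → inj (there p) (there q)) u

unique⇒lookup-injective : {xs : List A} → Unique xs →
                          ∀ {i j} → lookup xs i ≡ lookup xs j → i ≡ j
unique⇒lookup-injective (_  ∷ _) {zero}  {zero}  _  = refl
unique⇒lookup-injective (x∉ ∷ _) {zero}  {suc j} eqn =
  contradiction eqn (All.lookup x∉ (∈-lookup j))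
unique⇒lookup-injective (x∉ ∷ _) {suc i} {zero}  eqn =
  contradiction (sym eqn) (All.lookup x∉ (∈-lookup i))
unique⇒lookup-injective (_  ∷ u) {suc i} {suc j} eqn = cong suc (unique⇒lookup-injective u eqn)

-- Pigeonhole: positions with the same index hold the same entry, so in a list without repetitions
-- choosing indices is injective.
unique-in-image⇒length≤ : ∀ {d} {f : Fin d → A} {xs : List A} →
                          Unique xs → All (λ x → ∃[ i ] x ≡ f i) xs → length xs ≤ d
unique-in-image⇒length≤ {f = f} {xs} u im = injective⇒≤ {f = index} index-injective
  where
  index : Fin (length xs) → _
  index j = proj₁ (All.lookup im (∈-lookup j))

  index-injective : ∀ {i j} → index i ≡ index j → i ≡ j
  index-injective {i} {j} eqn = unique⇒lookup-injective u
    (trans (proj₂ (All.lookup im (∈-lookup i)))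
      (trans (cong f eqn) (sym (proj₂ (All.lookup im (∈-lookup j))))))

-- Only the term at `y` can shrink, and a list without repetitions contains it at most once. This is
-- applied to the lengths of the unread lists, one of which loses an entry in a query.
sum-decrease≤1 : (f g : A → ℕ) (y : A) → (∀ x → x ≢ y → f x ≡ g x) → f y ≤ suc (g y) →
                 (∀ x → Dec (x ≡ y)) →
                 {xs : List A} → Unique xs → sum (map f xs) ≤ suc (sum (map g xs))
sum-decrease≤1 f g y same drop x≟y []                 = z≤n
sum-decrease≤1 f g y same drop x≟y (_∷_ {x} {xs} x∉ u) with x≟y x
... | yes refl rewrite map-cong-local (All.map (λ {z} y≢z → same z (y≢z ∘ sym)) x∉) =
  +-monoˡ-≤ (sum (map g xs)) drop
... | no x≢y rewrite same x x≢y =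
  ≤-trans (+-monoʳ-≤ (g x) (sum-decrease≤1 f g y same drop x≟y u)) (≤-reflexive (+-suc (g x) _))

sum-constant : ∀ {c} (f : A → ℕ) {xs} → All (λ x → f x ≡ c) xs → sum (map f xs) ≡ length xs * c
sum-constant f []         = refl
sum-constant f (fx≡c ∷ h) = cong₂ _+_ fx≡c (sum-constant f h)

sum-positive : (f : A → ℕ) (xs : List A) → 0 < sum (map f xs) → ∃[ x ] x ∈ xs × 0 < f x
sum-positive f (x ∷ xs) 0<s with f x in eqn
... | suc _ = x , here refl , subst (0 <_) (sym eqn) (s≤s z≤n)
... | zero with sum-positive f xs 0<s
...   | y , y∈ , 0<fy = y , there y∈ , 0<fy

sum-tabulate≤ : ∀ m {n X Y} (f : Fin (m + n) → ℕ) →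
  (∀ i → f (i ↑ˡ n) ≤ X) → (∀ j → f (m ↑ʳ j) ≤ Y) → sum (tabulate f) ≤ m * X + n * Y
sum-tabulate≤ zero {zero} f left right = z≤n
sum-tabulate≤ zero {suc n} {X} f left right =
  +-mono-≤ (right zero) (sum-tabulate≤ zero {X = X} (f ∘ suc) (λ ()) (right ∘ suc))
sum-tabulate≤ (suc m) {X = X} f left right = ≤-trans
  (+-mono-≤ (left zero) (sum-tabulate≤ m (f ∘ suc) (left ∘ suc) right))
  (≤-reflexive (sym (+-assoc X (m * X) _)))

foldr-⊔≤ : ∀ {c} (f : A → ℕ) xs → (∀ x → f x ≤ c) → foldr _⊔_ 0 (map f xs) ≤ c
foldr-⊔≤ f []       f≤c = z≤n
foldr-⊔≤ f (x ∷ xs) f≤c = ⊔-lub (f≤c x) (foldr-⊔≤ f xs f≤c)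

first-satisfying : {P : A → Set} → (∀ x → Dec (P x)) → ∀ {xs} → Any P xs →
  ∃[ ys ] ∃[ y ] ∃[ zs ] xs ≡ ys ++ y ∷ zs × All (λ x → ¬ P x) ys × P y
first-satisfying P? {x ∷ xs} any with P? x
... | yes px = [] , x , xs , refl , [] , px
... | no ¬px with any
...   | here px     = contradiction px ¬px
...   | there later with first-satisfying P? later
...     | ys , y , zs , refl , ¬pys , py = x ∷ ys , y , zs , refl , ¬px ∷ ¬pys , py

unique-prefix : ∀ xs {ys : List A} → Unique (xs ++ ys) → Unique xs
unique-prefix []       u        = []
unique-prefix (x ∷ xs) (x∉ ∷ u) = All.++⁻ˡ xs x∉ ∷ unique-prefix xs u

-- Directed spanning trees

module _ {G : Digraph n} {T : List (Edge n)} where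

  outBranching-parent-unique : IsOutBranching G T →
    ∀ {u u′ v} → (u , v) ∈ T → (u′ , v) ∈ T → u ≡ u′
  outBranching-parent-unique B {v = v} p q = ,-injectiveˡ
    (length≤1⇒≡ (inDegree≤1 v) (∈-filter⁺ into? p refl) (∈-filter⁺ into? q refl))
    where
    open IsOutBranching B
    into? = λ e → proj₂ e ≟ v

  -- An edge of an out-branching is determined by its target, so that edges can be counted by their
  -- targets.
  outBranching-targets-unique : IsOutBranching G T → Unique (map proj₂ T)
  outBranching-targets-unique B = unique-map inj (IsOutBranching.distinct B)
    where
    inj : ∀ {e e′} → e ∈ T → e′ ∈ T → proj₂ e ≡ proj₂ e′ → e ≡ e′
    inj {_ , _} {_ , _} p q refl = cong (_, _) (outBranching-parent-unique B p q)

  root-no-parent : ∀ {r u} → IsDST G r T → (u , r) ∉ T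
  root-no-parent {r} dst p
    with filter (λ e → proj₂ e ≟ r) T | ∈-filter⁺ (λ e → proj₂ e ≟ r) p refl | IsDST.root dst
  ... | _ ∷ _ | _  | ()
  ... | []    | () | _

  -- Each step of an undirected walk follows a tree edge forwards or backwards, so the walk cannot
  -- leave a set whose boundary no tree edge crosses.
  connected⇒no-cut : ∀ {r} → IsDST G r T → (S : Fin n → Set) →
    (∀ {u v} → (u , v) ∈ T → S u → S v) → (∀ {u v} → (u , v) ∈ T → S v → S u) →
    ∀ u v → S u → S v
  connected⇒no-cut dst S forth back u v = along (IsDST.weaklyConnected dst u v)
    where
    along : ∀ {u v} → EqClosure (Joins T) u v → S u → S v
    along ε             = id
    along (fwd e ◅ es) = along es ∘ forth e
    along (bwd e ◅ es) = along es ∘ back e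

-- The rank drops strictly from a vertex to its parent. This excludes directed cycles and makes the
-- path of successive parents end in `r`.
module ParentTree (G : Digraph n) (r : Fin n) (parent : Fin n → Fin n) (rank : Fin n → ℕ)
  (parent-edge : ∀ v → v ≢ r → v ∈ adj G (parent v))
  (rank-parent : ∀ v → v ≢ r → rank (parent v) < rank v) where

  nonRoot : List (Fin n)
  nonRoot = filter (λ v → ¬? (v ≟ r)) (allFin n)

  parentEdge : Fin n → Edge n
  parentEdge v = parent v , v

  tree : List (Edge n)
  tree = map parentEdge nonRoot

  ∈-tree⁻ : ∀ {u v} → (u , v) ∈ tree → u ≡ parent v × v ≢ r
  ∈-tree⁻ p with ∈-map⁻ parentEdge p
  ... | v , v∈ , refl = refl , proj₂ (∈-filter⁻ (λ v → ¬? (v ≟ r)) {xs = allFin n} v∈)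

  ∈-tree⁺ : ∀ {v} → v ≢ r → (parent v , v) ∈ tree
  ∈-tree⁺ v≢r = ∈-map⁺ parentEdge (∈-filter⁺ (λ v → ¬? (v ≟ r)) (∈-allFin _) v≢r)

  tree-unique : Unique tree
  tree-unique = Unique.map⁺ ,-injectiveʳ (Unique.filter⁺ (λ v → ¬? (v ≟ r)) (Unique.allFin⁺ n))

  rank-increases : ∀ {u v} → TransClosure (Joins tree) u v → rank u < rank v
  rank-increases [ e ] with ∈-tree⁻ e
  ... | refl , v≢r = rank-parent _ v≢r
  rank-increases (e ∷ es) with ∈-tree⁻ e
  ... | refl , v≢r = <-trans (rank-parent _ v≢r) (rank-increases es)

  connected-to-root : ∀ v → EqClosure (Joins tree) v r
  connected-to-root v = go v (<-wellFounded (rank v))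
    where
    go : ∀ v → Acc _<_ (rank v) → EqClosure (Joins tree) v r
    go v (acc smaller) with v ≟ r
    ... | yes refl = ε
    ... | no  v≢r  = bwd (∈-tree⁺ v≢r) ◅ go (parent v) (smaller (rank-parent v v≢r))

  tree-isDST : IsDST G r tree
  tree-isDST = record
    { outBranching = record
      { distinct   = tree-unique
      ; subgraph   = λ u v p → subgraph p
      ; acyclic    = λ v p → <-irrefl refl (rank-increases p)
      ; inDegree≤1 = λ v → unique-constant⇒length≤1
          (Unique.filter⁺ (λ e → proj₂ e ≟ v) tree-unique)
          (All.tabulate (into v))
      }
    ; weaklyConnected = λ u v → connected-to-root u ◅◅ EqClosure.symmetric _ (connected-to-root v)
    ; root = cong length (filter-none (λ e → proj₂ e ≟ r)
        (All.tabulate λ { {_ , _} p refl → proj₂ (∈-tree⁻ p) refl }))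
    }
    where
    subgraph : ∀ {u v} → (u , v) ∈ tree → v ∈ adj G u
    subgraph p with ∈-tree⁻ p
    ... | refl , v≢r = parent-edge _ v≢r

    into : ∀ v {e} → e ∈ filter (λ e → proj₂ e ≟ v) tree → e ≡ parentEdge v
    into v {_ , _} p with ∈-filter⁻ (λ e → proj₂ e ≟ v) {xs = tree} p
    ... | e∈ , refl = cong (_, v) (proj₁ (∈-tree⁻ e∈))

-- Runs of the word RAM

-- All that the counting has to know about one machine step: at most one list loses its first entry.
data Reads {n} (τ : Fin n → List (Fin n)) : (Fin n → List (Fin n)) → Set where
  none : Reads τ τ
  one  : ∀ v {x xs} → τ v ≡ x ∷ xs → Reads τ (updateAt τ v (λ _ → xs))

unread : List (Fin n) → (Fin n → List (Fin n)) → ℕ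
unread vs τ = sum (map (length ∘ τ) vs)

reads-unread : ∀ {τ τ′ : Fin n → List (Fin n)} {vs} → Unique vs → Reads τ τ′ →
               unread vs τ ≤ suc (unread vs τ′)
reads-unread u none = n≤1+n _
reads-unread {τ = τ} u (one v {xs = xs} eqn) = sum-decrease≤1 _ _ v
  (λ x x≢v → cong length (sym (updateAt-minimal x v τ x≢v)))
  (≤-reflexive (trans (cong length eqn) (cong (suc ∘ length) (sym (updateAt-updates v τ)))))
  (λ x → x ≟ v) u

-- Reading only drops entries, so nonemptiness passes back in time.
reads-nonempty : ∀ {τ τ′ : Fin n → List (Fin n)} p → Reads τ τ′ →
                 0 < length (τ′ p) → 0 < length (τ p)
reads-nonempty p none nonempty = nonempty
reads-nonempty {τ = τ} p (one v eqn) nonempty with p ≟ v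
... | yes refl rewrite eqn = s≤s z≤n
... | no p≢v = subst (λ l → 0 < length l) (updateAt-minimal p v τ p≢v) nonempty

label-injective : {u v : Fin n} → label u ≡ label v → u ≡ v
label-injective = toℕ-injective ∘ suc-injective

module Execution (w : ℕ) (A : Program) {n : ℕ} (G : Digraph n) (r : Fin n) where
  open Machine w A G r

  neighbour-reads : ∀ dst mv s → Reads (todo s) (todo (queryNeighbour dst mv s))
  neighbour-reads dst nothing  s = none
  neighbour-reads dst (just v) s with todo s v in eqn
  ... | []    = none
  ... | _ ∷ _ = one v eqn

  exec-reads : ∀ i s → Reads (todo s) (todo (exec i s))
  exec-reads (const _ _)     s = none
  exec-reads (binop _ _ _ _) s = none
  exec-reads (load _ _)      s = none
  exec-reads (store _ _)     s = none
  exec-reads (jump _)        s = none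
  exec-reads (jumpZero x _)  s with regs s x ≡ᵇ 0
  ... | true  = none
  ... | false = none
  exec-reads (degree _ _)    s = none
  exec-reads (neighbour dst v) s = neighbour-reads dst (vertex n (regs s v)) s
  exec-reads (emit _ _)      s = none

  step-reads : ∀ s → Reads (todo s) (todo (step s))
  step-reads s with fetch s
  ... | nothing = none
  ... | just i  = exec-reads i s

  -- Every step lowers the number of unread entries by at most one.
  run-unread : ∀ {vs} → Unique vs → ∀ t → unread vs (adj G) ≤ t + unread vs (todo (run t))
  run-unread u zero    = ≤-refl
  run-unread u (suc t) = ≤-trans (run-unread u t)
    (≤-trans (+-monoʳ-≤ t (reads-unread u (step-reads (run t)))) (≤-reflexive (+-suc t _)))

  -- The first edge takes at most `b` steps, and each of the `length es` further ones, up to and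
  -- including `(u , v)`, at most `δ`.
  emitted-in-time : ∀ {δ t b} es {u v es′} → EmitsFrom δ t b (es ++ (u , v) ∷ es′) →
    ∃[ t₁ ] t₁ < t + (b + length es * δ) × emission t₁ ≡ just (label u , label v)
  emitted-in-time {b = b} [] (emit t₁ _ t₁< _ eqn _) rewrite +-identityʳ b = t₁ , t₁< , eqn
  emitted-in-time {δ} {t} {b} (_ ∷ es) (emit t₁ _ t₁< _ _ later)
    with emitted-in-time es later
  ... | t₂ , t₂< , eqn = t₂ , bound , eqn
    where
    open ≤-Reasoning
    bound = begin-strict
      t₂                                   <⟨ t₂< ⟩
      suc t₁ + (δ + length es * δ)         ≤⟨ +-monoˡ-≤ _ t₁< ⟩
      (t + b) + (δ + length es * δ)        ≡⟨ +-assoc t b _ ⟩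
      t + (b + (δ + length es * δ))        ∎

  -- The machine is silent before, between and after the listed edges, so any emission is that of a
  -- listed edge, and the labels determine its ends.
  emission⇒∈ : ∀ {δ t b es} → EmitsFrom δ t b es → ∀ t₁ → t ≤ t₁ →
    ∀ {u v} → emission t₁ ≡ just (label u , label v) → (u , v) ∈ es
  emission⇒∈ (done silent) t₁ t≤t₁ eqn with trans (sym eqn) (silent _ t≤t₁)
  ... | ()
  emission⇒∈ (emit t₂ _ _ silent eqn₂ later) t₁ t≤t₁ eqn with <-cmp t₁ t₂
  ... | tri< t₁<t₂ _ _ with () ← trans (sym eqn) (silent _ t≤t₁ t₁<t₂)
  ... | tri≈ _ refl _ = here (cong₂ _,_ (label-injective (,-injectiveˡ eqn′))
                                        (label-injective (,-injectiveʳ eqn′)))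
    where eqn′ = just-injective (trans (sym eqn) eqn₂)
  ... | tri> _ _ t₂<t₁ = there (emission⇒∈ later t₁ t₂<t₁ eqn)

-- Two graphs that differ only in the last entry x or y of the list of p are
-- indistinguishable until that entry is read.
module Lockstep (w : ℕ) (A : Program) {n : ℕ} (G H : Digraph n) (r : Fin n)
  (p x y : Fin n) where

  private
    module G = Machine w A G r
    module H = Machine w A H r

  -- In the second alternative `zs` is the common unread part, and the distinguishing entry is still
  -- ahead in both lists.
  Agree : Fin n → List (Fin n) → List (Fin n) → Set
  Agree v xs ys = xs ≡ ys ⊎ (v ≡ p × ∃[ zs ] xs ≡ zs ++ x ∷ [] × ys ≡ zs ++ y ∷ [])

  -- Registers, memory and lists are functions, and are compared pointwise to avoid function
  -- extensionality.
  record _∼_ (s s′ : State n) : Set where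
    constructor sim
    field
      pc-∼   : pc s ≡ pc s′
      regs-∼ : ∀ i → regs s i ≡ regs s′ i
      mem-∼  : ∀ i → mem s i ≡ mem s′ i
      todo-∼ : ∀ v → Agree v (todo s v) (todo s′ v)

  open _∼_

  ≔-cong : ∀ {f g : ℕ → ℕ} i {a b} → (∀ j → f j ≡ g j) → a ≡ b →
           ∀ j → (f [ i ≔ a ]) j ≡ (g [ i ≔ b ]) j
  ≔-cong i f≗g refl j with j ≡ᵇ i
  ... | true  = refl
  ... | false = f≗g j

  next-∼ : ∀ {s s′} → s ∼ s′ → G.next s ∼ H.next s′
  next-∼ (sim c ρ μ τ) = sim (cong suc c) ρ μ τ

  set-∼ : ∀ dst {a b s s′} → a ≡ b → s ∼ s′ → G.set dst a s ∼ H.set dst b s′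
  set-∼ dst refl (sim c ρ μ τ) = sim c (≔-cong dst ρ refl) μ τ

  updateAt-agree : ∀ {τ τ′ : Fin n → List (Fin n)} v {xs ys} →
    (∀ u → Agree u (τ u) (τ′ u)) → Agree v xs ys →
    ∀ u → Agree u (updateAt τ v (λ _ → xs) u) (updateAt τ′ v (λ _ → ys) u)
  updateAt-agree {τ} {τ′} v agree new u with u ≟ v
  ... | yes refl = subst₂ (Agree u) (sym (updateAt-updates u τ)) (sym (updateAt-updates u τ′)) new
  ... | no  u≢v  = subst₂ (Agree u) (sym (updateAt-minimal u v τ u≢v))
                                    (sym (updateAt-minimal u v τ′ u≢v)) (agree u)

  neighbour-∼ : ∀ dst mv {s s′} → s ∼ s′ → 0 < length (todo (G.queryNeighbour dst mv s) p) →
                G.queryNeighbour dst mv s ∼ H.queryNeighbour dst mv s′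
  neighbour-∼ dst nothing  s∼s′ _ = set-∼ dst refl s∼s′
  neighbour-∼ dst (just v) {s} {s′} s∼s′@(sim c ρ μ τ) unread
    with todo s v | todo s′ v | τ v
  ... | []     | _ | inj₁ refl = set-∼ dst refl s∼s′
  ... | z ∷ xs | _ | inj₁ refl =
    set-∼ dst refl (sim c ρ μ (updateAt-agree v τ (inj₁ refl)))
  ... | _ | _ | inj₂ (refl , z ∷ zs , refl , refl) =
    set-∼ dst refl (sim c ρ μ (updateAt-agree v τ (inj₂ (refl , zs , refl , refl))))
  -- Here the query returns the distinguishing entry itself. Afterwards the list of `p` is empty,
  -- against the assumption.
  ... | _ | _ | inj₂ (refl , [] , refl , refl)
    rewrite updateAt-updates p {λ _ → []} (todo s) with () ← unread

  module _ (same-degree : ∀ v → outDegree G v ≡ outDegree H v) where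

    queryDegree-∼ : ∀ mv → G.queryDegree mv ≡ H.queryDegree mv
    queryDegree-∼ nothing  = refl
    queryDegree-∼ (just v) = same-degree v

    exec-∼ : ∀ i {s s′} → s ∼ s′ → 0 < length (todo (G.exec i s) p) → G.exec i s ∼ H.exec i s′
    exec-∼ (const dst c) s∼s′ _ = next-∼ (set-∼ dst refl s∼s′)
    exec-∼ (binop op dst i j) s∼s′ _ =
      next-∼ (set-∼ dst (cong₂ (⟦ op ⟧ w) (regs-∼ s∼s′ i) (regs-∼ s∼s′ j)) s∼s′)
    exec-∼ (load dst i) {s} {s′} s∼s′ _ = next-∼ (set-∼ dst
      (trans (mem-∼ s∼s′ (regs s i)) (cong (mem s′) (regs-∼ s∼s′ i))) s∼s′)
    exec-∼ (store i j) {s} {s′} (sim c ρ μ τ) _ rewrite ρ i =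
      next-∼ (sim c ρ (≔-cong (regs s′ i) μ (ρ j)) τ)
    exec-∼ (jump _) (sim c ρ μ τ) _ = sim refl ρ μ τ
    exec-∼ (jumpZero i _) {s} {s′} (sim c ρ μ τ) _ rewrite ρ i with regs s′ i ≡ᵇ 0
    ... | true  = sim refl ρ μ τ
    ... | false = next-∼ (sim c ρ μ τ)
    exec-∼ (degree dst v) {s′ = s′} s∼s′ _ rewrite regs-∼ s∼s′ v =
      next-∼ (set-∼ dst (queryDegree-∼ (vertex n (regs s′ v))) s∼s′)
    exec-∼ (neighbour dst v) {s} {s′} s∼s′ unread rewrite regs-∼ s∼s′ v =
      next-∼ (neighbour-∼ dst (vertex n (regs s′ v)) s∼s′ unread)
    exec-∼ (emit _ _) s∼s′ _ = next-∼ s∼s′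

    step-∼ : ∀ {s s′} → s ∼ s′ → 0 < length (todo (G.step s) p) → G.step s ∼ H.step s′
    step-∼ {s} {s′} s∼s′ unread rewrite sym (pc-∼ s∼s′) with G.fetch s
    ... | nothing = s∼s′
    ... | just i  = exec-∼ i s∼s′ unread

    emitted-∼ : ∀ {s s′} → s ∼ s′ → G.emitted s ≡ H.emitted s′
    emitted-∼ {s} {s′} s∼s′ rewrite sym (pc-∼ s∼s′) with G.fetch s
    ... | just (emit u v)      = cong₂ (λ a b → just (a , b)) (regs-∼ s∼s′ u) (regs-∼ s∼s′ v)
    ... | just (const _ _)     = refl
    ... | just (binop _ _ _ _) = refl
    ... | just (load _ _)      = refl
    ... | just (store _ _)     = refl
    ... | just (jump _)        = refl
    ... | just (jumpZero _ _)  = refl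
    ... | just (degree _ _)    = refl
    ... | just (neighbour _ _) = refl
    ... | nothing              = refl

    module _ (adj-agree : ∀ v → Agree v (adj G v) (adj H v)) where

      initial-∼ : G.initial ∼ H.initial
      initial-∼ = sim refl inputs-∼ (λ _ → refl) adj-agree
        where
        inputs-∼ : ∀ i → regs G.initial i ≡ regs H.initial i
        inputs-∼ 0             = refl
        inputs-∼ 1             = refl
        inputs-∼ (suc (suc _)) = refl

      run-∼ : ∀ t → 0 < length (todo (G.run t) p) → G.run t ∼ H.run t
      run-∼ zero    _      = initial-∼
      run-∼ (suc t) unread = step-∼
        (run-∼ t (reads-nonempty p (Execution.step-reads w A G r (G.run t)) unread)) unread

      -- As lists never grow, an entry left in the list of `p` at time `t` keeps the two runs in
      -- lockstep at all earlier times as well.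
      emission-∼ : ∀ t {t₁} → t₁ ≤ t → 0 < length (todo (G.run t) p) →
                   G.emission t₁ ≡ H.emission t₁
      emission-∼ t {t₁} t₁≤t unread = emitted-∼ (run-∼ t₁ (earlier (≤⇒≤′ t₁≤t) unread))
        where
        earlier : ∀ {t} → t₁ ≤′ t → 0 < length (todo (G.run t) p) → 0 < length (todo (G.run t₁) p)
        earlier ≤′-refl           unread = unread
        earlier (≤′-step {t} t₁≤t) unread = earlier t₁≤t
          (reads-nonempty p (Execution.step-reads w A G r (G.run t)) unread)

-- The hard graphs

cyclicPred : Fin (suc n) → Fin (suc n)
cyclicPred zero    = Fin.fromℕ _
cyclicPred (suc i) = inject₁ i

cyclicSuc : Fin (suc n) → Fin (suc n)
cyclicSuc i with Top.view i
... | Top.‵fromℕ            = zero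
... | Top.‵inj₁ {i = j} _   = suc j

cyclicSuc-pred : (i : Fin (suc n)) → cyclicSuc (cyclicPred i) ≡ i
cyclicSuc-pred {n} zero rewrite Top.view-fromℕ n   = refl
cyclicSuc-pred (suc i)  rewrite Top.view-inject₁ i = refl

-- Holds from length two on. It makes the ring loopless, and supplies a second place for the entry
-- in the final contradiction.
cyclicSuc-≢ : (i : Fin (suc (suc n))) → cyclicSuc i ≢ i
cyclicSuc-≢ i with Top.view i
... | Top.‵fromℕ          = λ ()
... | Top.‵inj₁ {i = j} _ = λ eqn → contradiction (cong toℕ eqn)
  (λ e → 1+n≢n (trans e (toℕ-inject₁ j)))

-- Increases along the cycle except at its entry c.
cyclicRank : Fin n → Fin n → ℕ
cyclicRank {n} c i with toℕ c ≤? toℕ i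
... | yes _ = toℕ i
... | no  _ = toℕ i + n

-- The critical step is the wrap-around from the last position to `zero`. Either `zero` is the
-- entry, which is excluded, or it precedes the entry and its rank has the length of the cycle
-- added.
cyclicRank-pred : (c i : Fin (suc n)) → i ≢ c → cyclicRank c (cyclicPred i) < cyclicRank c i
cyclicRank-pred zero zero i≢c = contradiction refl i≢c
cyclicRank-pred {n} c@(suc _) zero i≢c with toℕ c ≤? toℕ (Fin.fromℕ n)
... | yes _   = s≤s (≤-reflexive (toℕ-fromℕ n))
... | no  c≰n = contradiction (subst (toℕ c ≤_) (sym (toℕ-fromℕ n)) (s≤s⁻¹ (toℕ<n c))) c≰n
cyclicRank-pred c (suc i) i≢c
  with toℕ c ≤? toℕ (inject₁ i) | toℕ c ≤? suc (toℕ i)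
... | yes _   | yes _   = s≤s (≤-reflexive (toℕ-inject₁ i))
... | yes c≤i | no  c≰i = contradiction
  (≤-trans c≤i (≤-trans (≤-reflexive (toℕ-inject₁ i)) (n≤1+n _))) c≰i
... | no  c≰i | yes c≤i = contradiction
  (subst (toℕ c ≤_) (sym (toℕ-inject₁ i))
    (s≤s⁻¹ (≤∧≢⇒< c≤i (λ eqn → i≢c (sym (toℕ-injective eqn)))))) c≰i
... | no  _   | no  _   = s≤s (+-monoˡ-≤ _ (≤-reflexive (toℕ-inject₁ i)))

module HardGraph (d k : ℕ) where

  -- The core is nonempty and the ring has at least two vertices, so that its entry can be moved.
  D L N : ℕ
  D = suc d
  L = suc (suc k)
  N = suc (D + L)

  root : Fin N
  root = zero

  core : Fin D → Fin N
  core i = suc (i ↑ˡ L)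

  ring : Fin L → Fin N
  ring j = suc (D ↑ʳ j)

  data Kind : Fin N → Set where
    isRoot : Kind root
    isCore : ∀ i → Kind (core i)
    isRing : ∀ j → Kind (ring j)

  kind : ∀ v → Kind v
  kind zero    = isRoot
  kind (suc v) with splitAt D v in eqn
  ... | inj₁ i = subst (Kind ∘ suc) (splitAt⁻¹-↑ˡ eqn) (isCore i)
  ... | inj₂ j = subst (Kind ∘ suc) (splitAt⁻¹-↑ʳ {D} eqn) (isRing j)

  cases : A → (Fin D → A) → (Fin L → A) → Fin N → A
  cases a f g zero    = a
  cases a f g (suc v) = [ f , g ]′ (splitAt D v)

  cases-core : ∀ {a : A} {f g} i → cases a f g (core i) ≡ f i
  cases-core {f = f} {g} i = cong [ f , g ]′ (splitAt-↑ˡ D i L)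

  cases-ring : ∀ {a : A} {f g} j → cases a f g (ring j) ≡ g j
  cases-ring {f = f} {g} j = cong [ f , g ]′ (splitAt-↑ʳ D L j)

  core-injective : ∀ {i i′} → core i ≡ core i′ → i ≡ i′
  core-injective {i} {i′} eqn = ↑ˡ-injective L i i′ (Fin.suc-injective eqn)

  ring-injective : ∀ {j j′} → ring j ≡ ring j′ → j ≡ j′
  ring-injective {j} {j′} eqn = ↑ʳ-injective D j j′ (Fin.suc-injective eqn)

  isCore? : Fin N → Bool
  isCore? = cases true (λ _ → true) (λ _ → false)

  core≢ring : ∀ {i j} → core i ≢ ring j
  core≢ring {i} {j} eqn
    with trans (sym (cases-core {a = true} {λ _ → true} {λ _ → false} i))
           (trans (cong isCore? eqn) (cases-ring {a = true} {λ _ → true} {λ _ → false} j))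
  ... | ()

  OnRing : Fin N → Set
  OnRing v = ∃[ j ] v ≡ ring j

  onRing? : ∀ v → Dec (OnRing v)
  onRing? v with kind v
  ... | isRoot   = no λ ()
  ... | isCore _ = no λ (_ , eqn) → core≢ring eqn
  ... | isRing j = yes (j , refl)

  otherCore : Fin D → List (Fin N)
  otherCore i = map (core ∘ punchIn i) (allFin d)

  -- A core vertex without exit points back to the root, so that all core
  -- vertices have the same degree.
  target : Maybe (Fin L) → Fin N
  target = maybe′ ring root

  -- The order matters: the exit stands last in a core list, so as long as anything in the list is
  -- unread, the exit is.
  neighbours : (Fin D → Maybe (Fin L)) → Fin N → List (Fin N)
  neighbours exit = cases
    (map core (allFin D))
    (λ i → otherCore i ++ target (exit i) ∷ [])
    (λ j → ring (cyclicSuc j) ∷ [])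

  target≢core : ∀ e {i} → target e ≢ core i
  target≢core nothing  ()
  target≢core (just _) eqn = core≢ring (sym eqn)

  target∉otherCore : ∀ e i → target e ∉ otherCore i
  target∉otherCore e i t∈ with ∈-map⁻ (core ∘ punchIn i) t∈
  ... | _ , _ , eqn = target≢core e eqn

  module _ (exit : Fin D → Maybe (Fin L)) where

    neighbours-core : ∀ i → neighbours exit (core i) ≡ otherCore i ++ target (exit i) ∷ []
    neighbours-core = cases-core {a = map core (allFin D)} {g = λ j → ring (cyclicSuc j) ∷ []}

    neighbours-ring : ∀ j → neighbours exit (ring j) ≡ ring (cyclicSuc j) ∷ []
    neighbours-ring = cases-ring
      {a = map core (allFin D)} {λ i → otherCore i ++ target (exit i) ∷ []}

    neighbours-simple : ∀ v → Unique (neighbours exit v)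
    neighbours-simple v with kind v
    ... | isRoot   = Unique.map⁺ core-injective (Unique.allFin⁺ D)
    ... | isCore i rewrite neighbours-core i = Unique.++⁺
      (Unique.map⁺ (punchIn-injective i _ _ ∘ core-injective) (Unique.allFin⁺ d))
      ([] ∷ [])
      λ { (t∈ , here refl) → target∉otherCore (exit i) i t∈ }
    ... | isRing j rewrite neighbours-ring j = [] ∷ []

    neighbours-loopless : ∀ v → v ∉ neighbours exit v
    neighbours-loopless v v∈ with kind v
    ... | isRoot with ∈-map⁻ core v∈
    ...   | _ , _ , ()
    neighbours-loopless v v∈ | isCore i rewrite neighbours-core i with ∈-++⁻ (otherCore i) v∈
    ... | inj₂ (here eqn) = target≢core (exit i) (sym eqn)
    ... | inj₁ v∈′ with ∈-map⁻ (core ∘ punchIn i) v∈′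
    ...   | i′ , _ , eqn = punchInᵢ≢i i i′ (sym (core-injective eqn))
    neighbours-loopless v v∈ | isRing j rewrite neighbours-ring j with v∈
    ... | here eqn = cyclicSuc-≢ j (sym (ring-injective eqn))

    graph : Digraph N
    graph = record
      { adj      = neighbours exit
      ; simple   = neighbours-simple
      ; loopless = neighbours-loopless
      }

    outDegree-root : outDegree graph root ≡ D
    outDegree-root = trans (length-map core (allFin D)) (length-tabulate {n = D} id)

    outDegree-core : ∀ i → outDegree graph (core i) ≡ D
    outDegree-core i = begin
      outDegree graph (core i)  ≡⟨ cong length (neighbours-core i) ⟩
      length (otherCore i ++ target (exit i) ∷ [])
                                ≡⟨ length-++ (otherCore i) ⟩
      length (otherCore i) + 1  ≡⟨ +-comm _ 1 ⟩
      suc (length (otherCore i))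
                                ≡⟨ cong suc (length-map (core ∘ punchIn i) (allFin d)) ⟩
      suc (length (allFin d))   ≡⟨ cong suc (length-tabulate {n = d} id) ⟩
      D                         ∎
      where open ≡-Reasoning

    outDegree-ring : ∀ j → outDegree graph (ring j) ≡ 1
    outDegree-ring j = cong length (neighbours-ring j)

    outDegree≤ : ∀ v → outDegree graph v ≤ D
    outDegree≤ v with kind v
    ... | isRoot   = ≤-reflexive outDegree-root
    ... | isCore i = ≤-reflexive (outDegree-core i)
    ... | isRing j = ≤-trans (≤-reflexive (outDegree-ring j)) (s≤s z≤n)

    maxOutDegree≡ : maxOutDegree graph ≡ D
    maxOutDegree≡ = ≤-antisym
      (foldr-⊔≤ (outDegree graph) (allFin N) outDegree≤)
      (≤-trans (≤-reflexive (sym outDegree-root)) 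
        (m≤m⊔n (outDegree graph root)
               (foldr _⊔_ 0 (map (outDegree graph) (tabulate suc)))))

    -- The root and each of the `D` core vertices contribute `D`, and each ring vertex contributes
    -- 1.
    edgeCount≤ : edgeCount graph ≤ D + (D * D + L)
    edgeCount≤ = ≤-trans
      (≤-reflexive (cong sum (map-tabulate {n = N} id (outDegree graph))))
      (+-mono-≤ (≤-reflexive outDegree-root)
        (≤-trans (sum-tabulate≤ D (outDegree graph ∘ suc)
                    (≤-reflexive ∘ outDegree-core) (≤-reflexive ∘ outDegree-ring))
                 (≤-reflexive (cong (λ l → D * D + l) (*-identityʳ L)))))

  noExit : Fin D → Maybe (Fin L)
  noExit _ = nothing

  -- The only way from the core into the ring leads from core a to ring c.
  exitAt : Fin D → Fin L → Fin D → Maybe (Fin L)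
  exitAt a c = updateAt noExit a (λ _ → just c)

  module _ (a : Fin D) (c : Fin L) where

    hardGraph : Digraph N
    hardGraph = graph (exitAt a c)

    -- The root and the core list only core vertices, apart from the last entries of the core lists.
    -- These are the root, except for `ring c` in the list of `core a`.
    into-ring : ∀ {u j} → ring j ∈ adj hardGraph u → OnRing u ⊎ (u ≡ core a × j ≡ c)
    into-ring {u} {j} p with kind u
    ... | isRing i = inj₁ (i , refl)
    ... | isRoot with ∈-map⁻ core p
    ...   | _ , _ , eqn = contradiction (sym eqn) core≢ring
    into-ring {u} {j} p | isCore i rewrite neighbours-core (exitAt a c) i with ∈-++⁻ (otherCore i) p
    ... | inj₁ q = contradiction (sym (proj₂ (proj₂ (∈-map⁻ (core ∘ punchIn i) q)))) core≢ring
    ... | inj₂ (here eqn) with i ≟ a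
    ...   | yes refl = inj₂
      (refl , ring-injective (trans eqn (cong target (updateAt-updates i noExit))))
    ...   | no i≢a with () ← trans eqn (cong target (updateAt-minimal i a noExit i≢a))

    out-of-ring : ∀ {u v} → v ∈ adj hardGraph u → OnRing u → OnRing v
    out-of-ring p (j , refl) rewrite neighbours-ring (exitAt a c) j with p
    ... | here eqn = cyclicSuc j , eqn

    -- The tree follows the cycle from its entry `ring c` onwards and leaves out the cycle edge into
    -- `ring c`.
    ringParent : Fin L → Fin N
    ringParent j with j ≟ c
    ... | yes _ = core a
    ... | no  _ = ring (cyclicPred j)

    parent : Fin N → Fin N
    parent = cases root (λ _ → root) ringParent

    rank : Fin N → ℕ
    rank = cases 0 (λ _ → 1) (λ j → 2 + cyclicRank c j)

    parent-core : ∀ i → parent (core i) ≡ root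
    parent-core = cases-core {a = root} {g = ringParent}

    parent-ring : ∀ j → parent (ring j) ≡ ringParent j
    parent-ring = cases-ring {a = root} {λ _ → root}

    rank-core : ∀ i → rank (core i) ≡ 1
    rank-core = cases-core {a = 0} {g = λ j → 2 + cyclicRank c j}

    rank-ring : ∀ j → rank (ring j) ≡ 2 + cyclicRank c j
    rank-ring = cases-ring {a = 0} {λ _ → 1}

    parent-edge : ∀ v → v ≢ root → v ∈ adj hardGraph (parent v)
    parent-edge v v≢r with kind v
    ... | isRoot   = contradiction refl v≢r
    ... | isCore i rewrite parent-core i = ∈-map⁺ core (∈-allFin i)
    ... | isRing j rewrite parent-ring j with j ≟ c
    ...   | yes refl rewrite neighbours-core (exitAt a j) a =
      ∈-++⁺ʳ (otherCore a) (here (cong target (sym (updateAt-updates a noExit))))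
    ...   | no  j≢c  rewrite neighbours-ring (exitAt a c) (cyclicPred j) =
      here (cong ring (sym (cyclicSuc-pred j)))

    rank-parent : ∀ v → v ≢ root → rank (parent v) < rank v
    rank-parent v v≢r with kind v
    ... | isRoot   = contradiction refl v≢r
    ... | isCore i rewrite parent-core i | rank-core i = s≤s z≤n
    ... | isRing j rewrite parent-ring j | rank-ring j with j ≟ c
    ...   | yes _   rewrite rank-core a = s≤s (s≤s z≤n)
    ...   | no  j≢c rewrite rank-ring (cyclicPred j) = s≤s (s≤s (cyclicRank-pred c j j≢c))

    hardInstance : Instance
    hardInstance = record
      { n = N ; G = hardGraph ; r = root
      ; hasDST = _ , ParentTree.tree-isDST hardGraph root parent rank parent-edge rank-parent
      }

    module _ {T : List (Edge N)} (dst : IsDST hardGraph root T) where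

      open IsDST dst using (outBranching)
      open IsOutBranching outBranching

      -- Without this edge no tree edge would cross between the ring and the rest in either
      -- direction, against connectedness. Membership is decidable, so arguing by contradiction is
      -- allowed.
      entry-in-tree : (core a , ring c) ∈ T
      entry-in-tree = decidable-stable (any? (≡-dec _≟_ _≟_ (core a , ring c)) T) λ missing →
        let u , eqn = connected⇒no-cut dst OnRing
              (λ p → out-of-ring (subgraph _ _ p))
              (λ { p (j , refl) → back missing p (into-ring (subgraph _ _ p)) })
              (ring zero) root (zero , refl)
        in contradiction eqn λ ()
        where
        back : ∀ {u j} → (core a , ring c) ∉ T → (u , ring j) ∈ T →
               OnRing u ⊎ (u ≡ core a × j ≡ c) → OnRing u
        back missing p (inj₁ onRing)        = onRing
        back missing p (inj₂ (refl , refl)) = contradiction p missing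

      -- The targets of these edges are distinct, and they lie in the core, since the root has no
      -- parent and the ring is excluded.
      prefix-bound : ∀ {es es′} → T ≡ es ++ es′ → All (λ e → ¬ OnRing (proj₂ e)) es → length es ≤ D
      prefix-bound {es} refl offRing = ≤-trans
        (≤-reflexive (sym (length-map proj₂ es)))
        (unique-in-image⇒length≤ {f = core}
          (unique-prefix (map proj₂ es)
            (subst Unique (map-++ proj₂ es _) (outBranching-targets-unique outBranching)))
          (All.map⁺ (All.tabulate λ {e} e∈ → onCore (∈-++⁺ˡ e∈) (All.lookup offRing e∈))))
        where
        onCore : ∀ {e} → e ∈ T → ¬ OnRing (proj₂ e) → ∃[ i ] proj₂ e ≡ core i
        onCore {_ , v} e∈ ¬ring with kind v
        ... | isRoot   = contradiction e∈ (root-no-parent dst)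
        ... | isCore i = i , refl
        ... | isRing j = contradiction (j , refl) ¬ring

  -- The time bounds may depend on the whole input, hence on `a` and `c`. The left side of `in-time`
  -- bounds the time up to the first edge into the ring, which at most `D` edges precede.
  module _ (w : ℕ → ℕ) (A : Program) (pre delay : Fin D → Fin L → ℕ)
    (in-time : ∀ a c → pre a c + delay a c + D * delay a c ≤ D * D)
    (enumerates : ∀ a c →
      Machine.EnumeratesDST (w N) A (hardGraph a c) root (pre a c) (delay a c)) where

    private
      -- suc T is D * D.
      T : ℕ
      T = d + d * D

      -- A reference input. It has no spanning tree from the root, so nothing is assumed about the
      -- program on it, but its run is defined and can be compared with all the others.
      closed : Digraph N
      closed = graph noExit

      module Closed = Machine (w N) A closed root
      module Hard (a : Fin D) (c : Fin L) = Machine (w N) A (hardGraph a c) root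

    -- The core lists hold `suc T` entries in total, and `T` steps read at most `T` of them.
    unread-core-entry : ∃[ a ] 0 < length (todo (Closed.run T) (core a))
    unread-core-entry
      with sum-positive (length ∘ todo (Closed.run T)) cores (+-cancelˡ-< T 0 _ enough)
      where
      cores = map core (allFin D)
      enough : T + 0 < T + unread cores (todo (Closed.run T))
      enough = begin-strict
        T + 0                      ≡⟨ +-identityʳ T ⟩
        T                          <⟨ n<1+n T ⟩
        D * D                      ≡⟨ cong (_* D) (outDegree-root noExit) ⟨
        length cores * D           ≡⟨ sum-constant (outDegree closed) (All.map⁺
                                        (All.universal (outDegree-core noExit) (allFin D))) ⟨
        unread cores (adj closed)  ≤⟨ Execution.run-unread (w N) A closed root
                                        (Unique.map⁺ core-injective (Unique.allFin⁺ D)) T ⟩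
        T + unread cores (todo (Closed.run T)) ∎
        where open ≤-Reasoning
    ... | v , v∈ , nonempty with ∈-map⁻ core v∈
    ...   | a , _ , refl = a , nonempty

    -- The two inputs differ only in the last entry of the list of `core a`, `root` against
    -- `ring c`, and this entry is unread up to time `T`.
    closed-emission : ∀ {a} → 0 < length (todo (Closed.run T) (core a)) →
      ∀ c {t} → t ≤ T → Closed.emission t ≡ Hard.emission a c t
    closed-emission {a} nonempty c t≤T =
      Lockstep.emission-∼ (w N) A closed (hardGraph a c) root (core a) root (ring c)
        same-degree agree T t≤T nonempty
      where
      open Lockstep (w N) A closed (hardGraph a c) root (core a) root (ring c) using (Agree)

      same-degree : ∀ v → outDegree closed v ≡ outDegree (hardGraph a c) v
      same-degree v with kind v
      ... | isRoot   = refl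
      ... | isCore i = trans (outDegree-core noExit i) (sym (outDegree-core (exitAt a c) i))
      ... | isRing j = trans (outDegree-ring noExit j) (sym (outDegree-ring (exitAt a c) j))

      agree : ∀ v → Agree v (adj closed v) (adj (hardGraph a c) v)
      agree v with kind v
      ... | isRoot   = inj₁ refl
      ... | isRing j = inj₁
        (trans (neighbours-ring noExit j) (sym (neighbours-ring (exitAt a c) j)))
      ... | isCore i with i ≟ a
      ...   | yes refl = inj₂ (refl , otherCore i , neighbours-core noExit i ,
        trans (neighbours-core (exitAt a c) i)
              (cong (λ e → otherCore i ++ target e ∷ []) (updateAt-updates i noExit)))
      ...   | no i≢a = inj₁ (trans (neighbours-core noExit i) (sym
        (trans (neighbours-core (exitAt a c) i)
               (cong (λ e → otherCore i ++ target e ∷ []) (updateAt-minimal i a noExit i≢a)))))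

    -- The tree has an edge into the ring, namely the entry. Splitting it at the first such edge
    -- leaves a prefix short enough for the time bounds.
    ring-edge-emitted : ∀ a c → ∃[ t ] t ≤ T ×
      ∃[ u ] ∃[ j ] Hard.emission a c t ≡ just (label u , label (ring j))
    ring-edge-emitted a c with enumerates a c
    ... | tree , dst , emits
      with first-satisfying (λ e → onRing? (proj₂ e)) (lose (entry-in-tree a c dst) (c , refl))
    ... | es , (u , _) , _ , eqn , offRing , (j , refl)
      with Execution.emitted-in-time (w N) A (hardGraph a c) root es
             (subst (Hard.EmitsFrom a c (delay a c) 0 (pre a c + delay a c)) eqn emits)
    ... | t , t< , emission = t , s≤s⁻¹ bound , u , j , emission
      where
      bound : t < D * D
      bound = <-≤-trans t< (≤-trans
        (+-monoʳ-≤ (pre a c + delay a c)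
          (*-monoˡ-≤ (delay a c) (prefix-bound a c dst eqn offRing)))
        (in-time a c))

    -- The edge emitted first into the ring, say into ring j, is also emitted when
    -- ring j is the entry; then it must come from core a, and this edge does not
    -- exist when the entry is elsewhere.
    too-fast⇒⊥ : ⊥
    too-fast⇒⊥ with unread-core-entry
    -- The entry `zero` is an arbitrary choice, made to find an emitted edge into some `ring j`.
    ... | a , nonempty with ring-edge-emitted a zero
    ... | t , t≤T , u , j , emission = cyclicSuc-≢ j (sym j≡suc)
      where
      emission-closed : Closed.emission t ≡ just (label u , label (ring j))
      emission-closed = trans (closed-emission nonempty zero t≤T) emission

      -- The emission at time `t` is the same for every entry, so one edge lies in the trees for all
      -- `c`. Below, `c` is taken to be `j` and then `cyclicSuc j`.
      emitted-in : ∀ c → (u , ring j) ∈ proj₁ (enumerates a c)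
      emitted-in c = Execution.emission⇒∈ (w N) A (hardGraph a c) root
        (proj₂ (proj₂ (enumerates a c))) t z≤n
        (trans (sym (closed-emission nonempty c t≤T)) emission-closed)

      tree-at : ∀ c → IsOutBranching (hardGraph a c) (proj₁ (enumerates a c))
      tree-at c = IsDST.outBranching (proj₁ (proj₂ (enumerates a c)))

      u≡core : u ≡ core a
      u≡core = outBranching-parent-unique (tree-at j) (emitted-in j)
        (entry-in-tree a j (proj₁ (proj₂ (enumerates a j))))

      j≡suc : j ≡ cyclicSuc j
      j≡suc with into-ring a (cyclicSuc j)
                   (IsOutBranching.subgraph (tree-at (cyclicSuc j)) _ _ (emitted-in (cyclicSuc j)))
      ... | inj₁ (_ , u≡ring) = contradiction (trans (sym u≡core) u≡ring) core≢ring
      ... | inj₂ (_ , eqn)    = eqn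

-- Asymptotics

quarter : ℚᵘ
quarter = mkℚᵘ (+ 1) 3

≤quarter⇒4*≤ : ∀ {x y} → fromℕ x ℚᵘ.≤ quarter ℚᵘ.* fromℕ y → 4 * x ≤ y
≤quarter⇒4*≤ {x} {y} (ℚᵘ.*≤* p) = ℤ.drop‿+≤+ (subst₂ ℤ._≤_ left right p)
  where
  left : + x ℤ.* + 4 ≡ + (4 * x)
  left = trans (sym (ℤ.pos-* x 4)) (cong +_ (*-comm x 4))
  right : (+ 1 ℤ.* + y) ℤ.* + 1 ≡ + y
  right = trans (ℤ.*-identityʳ _) (ℤ.*-identityˡ (+ y))

constant-littleO : ∀ c → LittleO U id (λ _ → fromℕ c) fromℕ
constant-littleO c (mkℚᵘ (+ zero) q)    (ℚᵘ.*<* (ℤ.+<+ ()))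
constant-littleO c (mkℚᵘ -[1+ p ] q)    (ℚᵘ.*<* ())
-- The denominator of the given rational is `suc q` and its numerator is at least 1, so `c * suc q`
-- is a sufficient threshold.
constant-littleO c (mkℚᵘ (+ suc p) q) _ = c * suc q , λ s _ large → ℚᵘ.*≤* (subst₂ ℤ._≤_
  (trans (cong (λ q → + (c * q)) (sym (*-identityʳ (suc q)))) (ℤ.pos-* c (suc q * 1)))
  (trans (ℤ.pos-* (suc p) s) (sym (ℤ.*-identityʳ _)))
  (ℤ.+≤+ (≤-trans large (m≤m+n s (p * s)))))

-- Each of the three summands is at most a quarter of `D * D`.
quarters-in-time : ∀ D pre delay → 4 * pre ≤ D * D → 4 * delay ≤ D → .{{NonZero D}} →
                   pre + delay + D * delay ≤ D * D
quarters-in-time D pre delay pre≤ delay≤ = *-cancelˡ-≤ 4 (begin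
  4 * (pre + delay + D * delay)           ≡⟨ distribute pre delay D ⟩
  4 * pre + 4 * delay + D * (4 * delay)   ≤⟨ +-mono-≤ (+-mono-≤ pre≤ (≤-trans delay≤ (m≤m*n D D)))
                                                      (*-monoʳ-≤ D delay≤) ⟩
  D * D + D * D + D * D                   ≤⟨ m≤m+n _ (D * D) ⟩
  D * D + D * D + D * D + D * D           ≡⟨ collect (D * D) ⟩
  4 * (D * D)                             ∎)
  where
  open ≤-Reasoning
  distribute : ∀ x y z → 4 * (x + y + z * y) ≡ 4 * x + 4 * y + z * (4 * y)
  distribute = solve-∀
  collect : ∀ x → x + x + x + x ≡ 4 * x
  collect = solve-∀

-- The lower bound for average out-degree at most 2

sparse-lower-bound : (w : ℕ → ℕ) →
  ¬ (∃[ A ] FastEnumeration w (λ I → avgΔ⁺ I ℚᵘ.≤ fromℕ 2) A)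
sparse-lower-bound w (A , pre , delay , pre-o , delay-o , enumerates)
  with pre-o quarter (ℚᵘ.*<* (ℤ.+<+ (s≤s z≤n))) | delay-o quarter (ℚᵘ.*<* (ℤ.+<+ (s≤s z≤n)))
... | s₁ , pre≤ | s₂ , delay≤ = too-fast⇒⊥ w A
  (λ a c → pre (hardInstance a c)) (λ a c → delay (hardInstance a c)) in-time
  (λ a c → enumerates (hardInstance a c) (sparse a c))
  where
  -- The first parameter makes `D` exceed both thresholds. The second is `D * D`, so that the ring,
  -- of out-degree 1, is long enough to outweigh the roughly `D * D` edges of the core in the
  -- average.
  open HardGraph (s₁ + s₂) (suc (s₁ + s₂) * suc (s₁ + s₂))

  Δ≡D : ∀ a c → Δ⁺ (hardInstance a c) ≡ D
  Δ≡D a c = maxOutDegree≡ (exitAt a c)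

  sparse : ∀ a c → avgΔ⁺ (hardInstance a c) ℚᵘ.≤ fromℕ 2
  sparse a c = ℚᵘ.*≤* (subst₂ ℤ._≤_ (sym (ℤ.*-identityʳ _)) (ℤ.pos-* 2 N)
    (ℤ.+≤+ (≤-trans (edgeCount≤ (exitAt a c)) edges≤)))
    where
    edges≤ : D + (D * D + L) ≤ 2 * N
    edges≤ = begin
      D + (D * D + L)                      ≤⟨ m≤m+n _ (D + 4) ⟩
      D + (D * D + (2 + D * D)) + (D + 4)  ≡⟨ count D (D * D) ⟩
      2 * N                                ∎
      where
      open ≤-Reasoning
      count : ∀ x y → x + (y + (2 + y)) + (x + 4) ≡ 2 * (1 + (x + (2 + y)))
      count = solve-∀

  in-time : ∀ a c → let I = hardInstance a c in pre I + delay I + D * delay I ≤ D * D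
  in-time a c = quarters-in-time D (pre I) (delay I)
    (subst (4 * pre I ≤_) (trans (cong (_^ 2) (Δ≡D a c)) (cong (D *_) (*-identityʳ D)))
      (≤quarter⇒4*≤ (pre≤ I (sparse a c) (large (m≤m+n s₁ s₂)))))
    (subst (4 * delay I ≤_) (Δ≡D a c)
      (≤quarter⇒4*≤ (delay≤ I (sparse a c) (large (m≤n+m s₂ s₁)))))
    where
    I = hardInstance a c
    large : ∀ {s} → s ≤ s₁ + s₂ → s ≤ Δ⁺ I
    large s≤ = ≤-trans s≤ (≤-trans (n≤1+n _) (≤-reflexive (sym (Δ≡D a c))))

-- Both the growth conditions and correctness are quantified over the inputs in the class, so they
-- restrict. This reduces the claim for all inputs to the sparse ones.
fast-on-subclass : ∀ {w 𝒞 𝒟 A} → (∀ I → 𝒟 I → 𝒞 I) →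
                   FastEnumeration w 𝒞 A → FastEnumeration w 𝒟 A
fast-on-subclass 𝒟⊆𝒞 (pre , delay , pre-o , delay-o , enumerates) = pre , delay
  , (λ ε 0<ε → let s , small = pre-o ε 0<ε in s , λ I → small I ∘ 𝒟⊆𝒞 I)
  , (λ ε 0<ε → let s , small = delay-o ε 0<ε in s , λ I → small I ∘ 𝒟⊆𝒞 I)
  , λ I → enumerates I ∘ 𝒟⊆𝒞 I

theorem13 : (w : ℕ → ℕ) → Ω-log w →
    (¬ (∃[ A ] FastEnumeration w U A)) ×
    (Σ[ a ∈ (ℕ → ℚᵘ) ] LittleO U id a fromℕ ×
    ¬ (∃[ A ] FastEnumeration w (λ I → avgΔ⁺ I ℚᵘ.≤ a (Δ⁺ I)) A))
theorem13 w _ =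
  (λ (A , fast) → sparse-lower-bound w (A , fast-on-subclass _ fast)) ,
  -- A constant bound on the average out-degree already grows more slowly than the maximum.
  (λ _ → fromℕ 2) , constant-littleO 2 , sparse-lower-bound w
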